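{- Let $\mathcal H=(V,E)$ be a hypergraph with splitting functions and let $R\subseteq V$ satisfy $0<\mathrm{vol}(R)\le\mathrm{vol}(\bar R)$. Let $\varepsilon_0=\mathrm{vol}(R)/\mathrm{vol}(\bar R)$, let $\varepsilon\in[\varepsilon_0,\varepsilon_0+1)$, and set $\mu=\varepsilon-\varepsilon_0\ge0$. Let $S^*$ be a minimizer of $\mathrm{HLC}$ over all subsets of $V$; this is the set returned by Algorithm 1. Let $T\subseteq V$ satisfy $0<\mathrm{vol}(T)\le\mathrm{vol}(\bar T)$, and suppose that for some $\beta\in\left(\frac{2\mu}{1+2\mu},1\right)$, $$\frac{\mathrm{vol}(T\cap R)}{\mathrm{vol}(T)}\ge\frac{\mathrm{vol}(\bar T\cap R)}{\mathrm{vol}(\bar T)}+\beta.$$ Then $$\mathrm{ncut}(S^*)\le\frac{1}{\beta+2\mu\beta-2\mu}\,\mathrm{ncut}(T).$$ In particular, when $\varepsilon=\varepsilon_0$ we get $\mathrm{ncut}(S^*)\le\frac1\beta\mathrm{ncut}(T)$.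
   Context: A hypergraph $\mathcal H=(V,E)$ has a finite node set $V$, and each hyperedge $e\in E$ is a subset of $V$. Each hyperedge $e$ carries a splitting function $w_e:2^e\to\mathbb R_{\ge0}$ satisfying $w_e(A)=w_e(e\setminus A)$ for all $A\subseteq e$ and $w_e(\emptyset)=w_e(e)=0$. For $S\subseteq V$, $\mathrm{cut}_{\mathcal H}(S)=\sum_{e\in E}w_e(e\cap S)$. The degree of $v$ is $d_v=\sum_{e\ni v}w_e(\{v\})$, and $\mathrm{vol}(S)=\sum_{v\in S}d_v$. Write $\bar S=V\setminus S$. Hypergraph normalized cut is $\mathrm{ncut}(S)=\frac{\mathrm{cut}_{\mathcal H}(S)}{\mathrm{vol}(S)}+\frac{\mathrm{cut}_{\mathcal H}(\bar S)}{\mathrm{vol}(\bar S)}$. Define $\Omega_{R,\varepsilon}(S)=\mathrm{vol}(S\cap R)-\varepsilon\,\mathrm{vol}(S\cap\bar R)$. Set $\mathrm{HLC}(S)=\mathrm{cut}_{\mathcal H}(S)/\Omega_{R,\varepsilon}(S)$ if $\Omega_{R,\varepsilon}(S)>0$, and $\mathrm{HLC}(S)=\infty$ otherwise. -}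

module Defs where

open import Level using (Level; suc; _⊔_)
open import Algebra.Apartness.Bundles using (HeytingField; HeytingCommutativeRing)
open import Algebra.Bundles using (CommutativeRing)
open import Data.Bool.Base using (if_then_else_)
open import Data.Empty using (⊥-elim)
open import Data.Fin.Base using (Fin)
open import Data.Fin.Subset using (Subset; _⊆_; _∩_; _─_; ∁; ⁅_⁆) renaming (⊥ to ∅)
open import Data.Fin.Subset.Properties using (_∈?_)
open import Data.Nat.Base using (ℕ)
open import Data.Product.Base using (Σ-syntax; _,_; proj₁; proj₂)
open import Data.Sum.Base using (_⊎_; inj₁; inj₂)
open import Function.Definitions using (Injective)
open import Relation.Binary.Core using (Rel)
open import Relation.Binary.PropositionalEquality.Core using (_≡_)
open import Relation.Binary.Structures using (IsStrictPartialOrder)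
open import Relation.Nullary.Decidable.Core using (does)
open import Relation.Nullary.Negation.Core using (¬_)
import Algebra.Apartness.Properties.HeytingCommutativeRing as HeytingProperties
import Algebra.Properties.CommutativeMonoid.Sum as Sum
import Algebra.Properties.Ring as RingProperties

-- A value of A ∪ {∞}, where ∞ means that Finite is uninhabited. For real
-- numbers, whether a value is finite may be undecidable, so this is not a
-- sum type.

record Extended {a : Level} (p : Level) (A : Set a) : Set (a ⊔ suc p) where
  field
    Finite : Set p
    value  : Finite → A

-- Ordered fields in the constructive sense: the order is not assumed
-- decidable or trichotomous. The constructive and the classical real numbers
-- are both instances, as is every classical ordered field (with x # y taken
-- to be x ≉ y).

record OrderedField (c ℓ₁ ℓ₂ ℓ₃ : Level) : Set (suc (c ⊔ ℓ₁ ⊔ ℓ₂ ⊔ ℓ₃)) where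
  infix 4 _<_ _≤_ _≤∞_
  infixl 7 _/_[_]

  field
    heytingField : HeytingField c ℓ₁ ℓ₂

  open HeytingField heytingField public

  field
    _<_                  : Rel Carrier ℓ₃
    isStrictPartialOrder : IsStrictPartialOrder _≈_ _<_
    <⇒#                  : ∀ {x y} → x < y → x # y
    #⇒<⊎>                : ∀ {x y} → x # y → x < y ⊎ y < x
    +-monoˡ-<            : ∀ z {x y} → x < y → x + z < y + z
    *-pos                : ∀ {x y} → 0# < x → 0# < y → 0# < x * y

  open IsStrictPartialOrder isStrictPartialOrder public
    using (<-resp-≈; <-respʳ-≈; <-respˡ-≈)
    renaming (irrefl to <-irrefl; trans to <-trans; asym to <-asym)

  open CommutativeRing (HeytingCommutativeRing.commutativeRing heytingCommutativeRing) public
    using (ring; +-commutativeMonoid)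

  _≤_ : Rel Carrier ℓ₃
  x ≤ y = ¬ (y < x)

  2# : Carrier
  2# = 1# + 1#

  -- #⇒invertible inverts y - 0#, which is ≈ y.
  _/_[_] : ∀ x y → 0# < y → Carrier
  x / y [ 0<y ] = x * proj₁ (#⇒invertible (#-sym (<⇒# 0<y)))

  _≤∞_ : ∀ {p} → Rel (Extended p Carrier) (ℓ₃ ⊔ p)
  x ≤∞ y = (fy : Finite y) → Σ[ fx ∈ Finite x ] value x fx ≤ value y fy
    where open Extended

  private
    module H = HeytingProperties heytingCommutativeRing
    module R = RingProperties ring

  <-cotrans : ∀ {x y} → x < y → ∀ z → x < z ⊎ z < y
  <-cotrans x<y z with #-cotrans (<⇒# x<y) z
  ... | inj₁ x#z with #⇒<⊎> x#z
  ...   | inj₁ x<z = inj₁ x<z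
  ...   | inj₂ z<x = inj₂ (<-trans z<x x<y)
  <-cotrans x<y z | inj₂ z#y with #⇒<⊎> z#y
  ...   | inj₁ z<y = inj₂ z<y
  ...   | inj₂ y<z = inj₁ (<-trans x<y y<z)

  <-≤-trans : ∀ {x y z} → x < y → y ≤ z → x < z
  <-≤-trans {z = z} x<y y≤z with <-cotrans x<y z
  ... | inj₁ x<z = x<z
  ... | inj₂ z<y = ⊥-elim (y≤z z<y)

  private
    x+y-y≈x : ∀ x y → (x + y) - y ≈ x
    x+y-y≈x x y = trans (+-assoc x y (- y)) (trans (+-congˡ (-‿inverseʳ y)) (+-identityʳ x))

    x-y+y≈x : ∀ x y → (x - y) + y ≈ x
    x-y+y≈x x y = trans (+-assoc x (- y) y) (trans (+-congˡ (-‿inverseˡ y)) (+-identityʳ x))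

    +-cancelʳ-< : ∀ z {x y} → x + z < y + z → x < y
    +-cancelʳ-< z {x} {y} p = <-respˡ-≈ (x+y-y≈x x z) (<-respʳ-≈ (x+y-y≈x y z) (+-monoˡ-< (- z) p))

    0<1 : 0# < 1#
    0<1 with #⇒<⊎> H.1#0
    ... | inj₂ p = p
    ... | inj₁ 1<0 = ⊥-elim (<-asym 1<0 (<-respʳ-≈ -1*-1≈1 (*-pos 0<-1 0<-1)))
      where
      0<-1 : 0# < - 1#
      0<-1 = <-respˡ-≈ (-‿inverseʳ 1#) (<-respʳ-≈ (+-identityˡ (- 1#)) (+-monoˡ-< (- 1#) 1<0))
      -1*-1≈1 : (- 1#) * (- 1#) ≈ 1#
      -1*-1≈1 = trans (R.-1*x≈-x (- 1#)) (R.-‿involutive 1#)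

  0<1+2[y-x] : ∀ {x y} → x ≤ y → 0# < 1# + 2# * (y - x)
  0<1+2[y-x] {x} {y} x≤y with <-cotrans 0<1 (1# + 2# * (y - x))
  ... | inj₁ p = p
  ... | inj₂ p = ⊥-elim (d+d≮0 (<-respˡ-≈ 2d≈d+d 2d<0))
    where
    d = y - x
    2d≈d+d : 2# * d ≈ d + d
    2d≈d+d = trans (distribʳ d 1# 1#) (+-cong (*-identityˡ d) (*-identityˡ d))
    2d<0 : 2# * d < 0#
    2d<0 = +-cancelʳ-< 1# (<-respˡ-≈ (+-comm 1# (2# * d)) (<-respʳ-≈ (sym (+-identityˡ 1#)) p))
    d≮0 : ¬ (d < 0#)
    d≮0 d<0 = x≤y (<-respˡ-≈ (x-y+y≈x y x) (<-respʳ-≈ (+-identityˡ x) (+-monoˡ-< x d<0)))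
    d+d≮0 : ¬ (d + d < 0#)
    d+d≮0 q with <-cotrans q d
    ... | inj₁ r = d≮0 (+-cancelʳ-< d (<-respʳ-≈ (sym (+-identityˡ d)) r))
    ... | inj₂ r = d≮0 r

module _ {c ℓ₁ ℓ₂ ℓ₃ : Level} (F : OrderedField c ℓ₁ ℓ₂ ℓ₃) where
  open OrderedField F
  open Sum +-commutativeMonoid using (sum-syntax)

  record Hypergraph : Set (c ⊔ ℓ₁ ⊔ ℓ₃) where
    field
      n m            : ℕ
      edge           : Fin m → Subset n
      edge-injective : Injective _≡_ _≡_ edge
      -- w i A is the value at A of the splitting function of edge i; it is
      -- constrained and used only for A ⊆ edge i.
      w              : Fin m → Subset n → Carrier
      w-nonneg       : ∀ i {A} → A ⊆ edge i → 0# ≤ w i A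
      w-symmetric    : ∀ i {A} → A ⊆ edge i → w i A ≈ w i (edge i ─ A)
      w-∅            : ∀ i → w i ∅ ≈ 0#
      w-edge         : ∀ i → w i (edge i) ≈ 0#

    cut : Subset n → Carrier
    cut S = ∑[ i < m ] w i (edge i ∩ S)

    degree : Fin n → Carrier
    degree v = ∑[ i < m ] (if does (v ∈? edge i) then w i ⁅ v ⁆ else 0#)

    vol : Subset n → Carrier
    vol S = ∑[ v < n ] (if does (v ∈? S) then degree v else 0#)

    ncut : (S : Subset n) → 0# < vol S → 0# < vol (∁ S) → Carrier
    ncut S 0<volS 0<vol∁S = cut S / vol S [ 0<volS ] + cut (∁ S) / vol (∁ S) [ 0<vol∁S ]

    Ω : Subset n → Carrier → Subset n → Carrier
    Ω R ε S = vol (S ∩ R) - ε * vol (S ∩ ∁ R)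

    HLC : Subset n → Carrier → Subset n → Extended ℓ₃ Carrier
    HLC R ε S = record
      { Finite = 0# < Ω R ε S
      ; value  = λ 0<Ω → cut S / Ω R ε S [ 0<Ω ]
      }

    IsMinimizerHLC : Subset n → Carrier → Subset n → Set ℓ₃
    IsMinimizerHLC R ε S* = ∀ S → HLC R ε S* ≤∞ HLC R ε S

{-# OPTIONS --safe #-}

-- Write a = vol(S ∩ R), b = vol(S ∩ ∁R), a′ = vol(∁S ∩ R), b′ = vol(∁S ∩ ∁R)
-- and r′ = vol(∁R) = b + b′. Since ε₀ r′ = vol R = a + a′, one has
--   r′ Ω(S) + μ r′ b + a′ b = a b′.
-- Dropping nonnegative terms gives r′ Ω(S) ≤ vol(S) vol(∁S) for every S. For T
-- the overlap hypothesis says β t t′ ≤ a b′ - a′ b with t = vol(T), t′ = vol(∁T);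
-- it also bounds the error term, μ r′ b ≤ 2μ(1 - β) t t′, because r′ ≤ 2t′.
-- Hence D t t′ ≤ r′ Ω(T). As ncut(S) = cut(S) vol(V) / (vol(S) vol(∁S)), the
-- two bounds sandwich HLC between multiples of ncut, and minimality of S*
-- transfers the comparison.
module Submission where

open import Defs
open import Algebra.Apartness.Bundles using (HeytingCommutativeRing)
open import Algebra.Bundles using (CommutativeMonoid; CommutativeRing)
open import Data.Bool.Base using (Bool; true; false; not; _∧_; if_then_else_)
open import Data.Empty using (⊥-elim)
open import Data.Fin.Base using (Fin; zero; suc)
open import Data.Fin.Subset using (Subset; _∩_; _─_; _∈_; ∁; ⁅_⁆; inside; outside)
open import Data.Fin.Subset.Properties using (_∈?_; p∩q⊆p; x∈⁅y⁆⇒x≡y; ∩-comm)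
open import Data.Product.Base using (Σ-syntax; _×_; _,_; proj₁; proj₂)
open import Data.Sum.Base using (inj₁; inj₂)
open import Data.Vec.Base using (_∷_; []; lookup)
open import Data.Vec.Properties using (lookup-map; lookup-zipWith)
open import Relation.Binary.Bundles using (Preorder)
open import Relation.Binary.PropositionalEquality as ≡ using (_≡_)
open import Relation.Nullary.Decidable using (does; yes; no)
import Algebra.Properties.CommutativeMonoid.Sum as Sum
import Algebra.Properties.CommutativeSemigroup as CommutativeSemigroupProperties
import Algebra.Properties.Ring as RingProperties
import Algebra.Solver.Ring.NaturalCoefficients.Default as SemiringSolver
import Data.Nat.Base as ℕ
import Relation.Binary.Reasoning.Preorder as PreorderReasoning

-- Subsets as Boolean vectors.

-- Brings `edge i ∩ ∁ S` into the relative form in which `w-symmetric` speaks of complements.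
∩-∁-relative : ∀ {n} (p q : Subset n) → p ∩ ∁ q ≡ p ─ (p ∩ q)
∩-∁-relative []            []            = ≡.refl
∩-∁-relative (inside  ∷ p) (inside  ∷ q) = ≡.cong (outside ∷_) (∩-∁-relative p q)
∩-∁-relative (inside  ∷ p) (outside ∷ q) = ≡.cong (inside ∷_) (∩-∁-relative p q)
∩-∁-relative (outside ∷ p) (inside  ∷ q) = ≡.cong (outside ∷_) (∩-∁-relative p q)
∩-∁-relative (outside ∷ p) (outside ∷ q) = ≡.cong (outside ∷_) (∩-∁-relative p q)

-- Turns the membership tests inside `vol` into Boolean lookups, where intersection and complement
-- act pointwise.
does-∈? : ∀ {n} (v : Fin n) (p : Subset n) → does (v ∈? p) ≡ lookup p v
does-∈? zero    (inside  ∷ p) = ≡.refl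
does-∈? zero    (outside ∷ p) = ≡.refl
does-∈? (suc v) (x ∷ p)       = does-∈? v p

-- Order and arithmetic in an ordered field without trichotomy.

module OrderedFieldProperties {c ℓ₁ ℓ₂ ℓ₃} (F : OrderedField c ℓ₁ ℓ₂ ℓ₃) where
  open OrderedField F hiding (zero)

  private
    commutativeRing : CommutativeRing c ℓ₁
    commutativeRing = HeytingCommutativeRing.commutativeRing heytingCommutativeRing

  open RingProperties ring using (+-cancelʳ; -0#≈0#; //-rightDividesˡ; //-rightDividesʳ)
  open Sum +-commutativeMonoid using (sum)
  open SemiringSolver (CommutativeRing.commutativeSemiring commutativeRing)
    using (solve; _:=_; _:+_; _:*_)

  ≤-reflexive : ∀ {x y} → x ≈ y → x ≤ y
  ≤-reflexive x≈y = <-irrefl (sym x≈y)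

  -- Since `≤` is a negated `<`, cotransitivity does the work of trichotomy: a counterexample
  -- `z < x` has `y` on one side or the other.
  ≤-trans : ∀ {x y z} → x ≤ y → y ≤ z → x ≤ z
  ≤-trans {y = y} x≤y y≤z z<x with <-cotrans z<x y
  ... | inj₁ z<y = y≤z z<y
  ... | inj₂ y<x = x≤y y<x

  ≤-preorder : Preorder c ℓ₁ ℓ₃
  ≤-preorder = record
    { _≲_        = _≤_
    ; isPreorder = record
      { isEquivalence = isEquivalence
      ; reflexive     = ≤-reflexive
      ; trans         = ≤-trans
      }
    }

  open PreorderReasoning ≤-preorder

  <⇒≤ : ∀ {x y} → x < y → x ≤ y
  <⇒≤ x<y y<x = <-asym x<y y<x

  +-cancelʳ-< : ∀ z {x y} → x + z < y + z → x < y
  +-cancelʳ-< z {x} {y} p =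
    <-respˡ-≈ (//-rightDividesʳ z x) (<-respʳ-≈ (//-rightDividesʳ z y) (+-monoˡ-< (- z) p))

  +-cancelʳ-≤ : ∀ z {x y} → x + z ≤ y + z → x ≤ y
  +-cancelʳ-≤ z p y<x = p (+-monoˡ-< z y<x)

  +-monoˡ-≤ : ∀ z {x y} → x ≤ y → x + z ≤ y + z
  +-monoˡ-≤ z x≤y p = x≤y (+-cancelʳ-< z p)

  +-monoʳ-≤ : ∀ z {x y} → x ≤ y → z + x ≤ z + y
  +-monoʳ-≤ z {x} {y} x≤y = begin
    z + x ≈⟨ +-comm z x ⟩
    x + z ≲⟨ +-monoˡ-≤ z x≤y ⟩
    y + z ≈⟨ +-comm y z ⟩
    z + y ∎

  0≤y⇒x≤x+y : ∀ {x y} → 0# ≤ y → x ≤ x + y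
  0≤y⇒x≤x+y {x} {y} 0≤y = begin
    x      ≈⟨ +-identityʳ x ⟨
    x + 0# ≲⟨ +-monoʳ-≤ x 0≤y ⟩
    x + y  ∎

  +-nonneg : ∀ {x y} → 0# ≤ x → 0# ≤ y → 0# ≤ x + y
  +-nonneg 0≤x 0≤y = ≤-trans 0≤x (0≤y⇒x≤x+y 0≤y)

  x<y⇒0<y-x : ∀ {x y} → x < y → 0# < y - x
  x<y⇒0<y-x {x} x<y = <-respˡ-≈ (-‿inverseʳ x) (+-monoˡ-< (- x) x<y)

  x≤y⇒0≤y-x : ∀ {x y} → x ≤ y → 0# ≤ y - x
  x≤y⇒0≤y-x {x} {y} x≤y = begin
    0#    ≈⟨ -‿inverseʳ x ⟨
    x - x ≲⟨ +-monoˡ-≤ (- x) x≤y ⟩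
    y - x ∎

  *-monoˡ-< : ∀ {x y z} → 0# < z → x < y → x * z < y * z
  *-monoˡ-< {x} {y} {z} 0<z x<y =
    <-respˡ-≈ (+-identityˡ (x * z))
      (<-respʳ-≈ regroup (+-monoˡ-< (x * z) (*-pos (x<y⇒0<y-x x<y) 0<z)))
    where
    regroup : (y - x) * z + x * z ≈ y * z
    regroup = trans (sym (distribʳ z (y - x) x)) (*-congʳ (//-rightDividesˡ x y))

  *-cancelʳ-≤ : ∀ {x y z} → 0# < z → x * z ≤ y * z → x ≤ y
  *-cancelʳ-≤ 0<z p y<x = p (*-monoˡ-< 0<z y<x)

  y<0⇒x*y<0 : ∀ {x y} → 0# < x → y < 0# → x * y < 0#
  y<0⇒x*y<0 {x} {y} 0<x y<0 =
    <-respˡ-≈ (*-comm y x) (<-respʳ-≈ (zeroˡ x) (*-monoˡ-< 0<x y<0))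

  -- If `z` inverts `x * y`, then `z * x` inverts `y`. This yields apartness of a factor, and with
  -- it a decision of its sign, where the order alone is undecidable.
  x*y#0⇒y#0 : ∀ {x y} → x * y # 0# → y # 0#
  x*y#0⇒y#0 {x} {y} xy#0 with #⇒invertible xy#0
  ... | z , z*xy≈1 , _ = invertible⇒# (z * x , inverseˡ , trans (*-comm _ _) inverseˡ)
    where
    x-0≈x : ∀ u → u - 0# ≈ u
    x-0≈x u = trans (+-congˡ -0#≈0#) (+-identityʳ u)

    inverseˡ : z * x * (y - 0#) ≈ 1#
    inverseˡ = begin-equality
      z * x * (y - 0#)   ≈⟨ *-congˡ (x-0≈x y) ⟩
      z * x * y          ≈⟨ *-assoc z x y ⟩
      z * (x * y)        ≈⟨ *-congˡ (x-0≈x (x * y)) ⟨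
      z * (x * y - 0#)   ≈⟨ z*xy≈1 ⟩
      1#                 ∎

  0≤1 : 0# ≤ 1#
  -- At `x = y = 0` the positive quantity `1 + 2(y - x)` collapses to `1#`.
  0≤1 = <⇒≤ (<-respʳ-≈ 1+2[0-0]≈1 (0<1+2[y-x] (≤-reflexive (refl {0#}))))
    where
    1+2[0-0]≈1 : 1# + 2# * (0# - 0#) ≈ 1#
    1+2[0-0]≈1 = trans (+-congˡ (trans (*-congˡ (-‿inverseʳ 0#)) (zeroʳ 2#))) (+-identityʳ 1#)

  -- The product being apart from zero makes `y` apart from zero, so `y` has a sign; a negative one
  -- would make the product negative.
  *-pos-cancelˡ : ∀ {x y} → 0# < x → 0# < x * y → 0# < y
  *-pos-cancelˡ 0<x 0<xy with #⇒<⊎> (x*y#0⇒y#0 (#-sym (<⇒# 0<xy)))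
  ... | inj₁ y<0 = ⊥-elim (<-asym 0<xy (y<0⇒x*y<0 0<x y<0))
  ... | inj₂ 0<y = 0<y

  -- A negative product would make both factors apart from 0, hence positive.
  *-nonneg : ∀ {x y} → 0# ≤ x → 0# ≤ y → 0# ≤ x * y
  *-nonneg {x} {y} 0≤x 0≤y xy<0
    with #⇒<⊎> (x*y#0⇒y#0 {x} {y} (<⇒# xy<0))
       | #⇒<⊎> (x*y#0⇒y#0 {y} {x} (<⇒# (<-respˡ-≈ (*-comm x y) xy<0)))
  ... | inj₁ y<0 | _        = 0≤y y<0
  ... | _        | inj₁ x<0 = 0≤x x<0
  ... | inj₂ 0<y | inj₂ 0<x = <-asym xy<0 (*-pos 0<x 0<y)

  *-monoˡ-≤ : ∀ {x y z} → 0# ≤ z → x ≤ y → x * z ≤ y * z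
  *-monoˡ-≤ {x} {y} {z} 0≤z x≤y = begin
    x * z               ≲⟨ 0≤y⇒x≤x+y (*-nonneg (x≤y⇒0≤y-x x≤y) 0≤z) ⟩
    x * z + (y - x) * z ≈⟨ distribʳ z x (y - x) ⟨
    (x + (y - x)) * z   ≈⟨ *-congʳ (trans (+-comm x (y - x)) (//-rightDividesˡ x y)) ⟩
    y * z               ∎

  *-monoʳ-≤ : ∀ {x y z} → 0# ≤ z → x ≤ y → z * x ≤ z * y
  *-monoʳ-≤ {x} {y} {z} 0≤z x≤y = begin
    z * x ≈⟨ *-comm z x ⟩
    x * z ≲⟨ *-monoˡ-≤ 0≤z x≤y ⟩
    y * z ≈⟨ *-comm y z ⟩
    z * y ∎

  -- Quotients and the clearing of denominators.

  /-*-cancel : ∀ x {y} (0<y : 0# < y) → x / y [ 0<y ] * y ≈ x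
  /-*-cancel x {y} 0<y with #⇒invertible (#-sym (<⇒# 0<y))
  ... | z , z*y≈1 , _ = begin-equality
    x * z * y        ≈⟨ *-assoc x z y ⟩
    x * (z * y)      ≈⟨ *-congˡ (*-congˡ (trans (+-congˡ -0#≈0#) (+-identityʳ y))) ⟨
    x * (z * (y - 0#)) ≈⟨ *-congˡ z*y≈1 ⟩
    x * 1#           ≈⟨ *-identityʳ x ⟩
    x                ∎

  sum-nonneg : ∀ {n} (f : Fin n → Carrier) → (∀ i → 0# ≤ f i) → 0# ≤ sum f
  sum-nonneg {ℕ.zero}  f 0≤f = ≤-reflexive refl
  sum-nonneg {ℕ.suc n} f 0≤f = +-nonneg (0≤f zero) (sum-nonneg (λ i → f (suc i)) (λ i → 0≤f (suc i)))

  /-nonneg : ∀ {x y} (0<y : 0# < y) → 0# ≤ x → 0# ≤ x / y [ 0<y ]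
  /-nonneg {x} {y} 0<y 0≤x = *-cancelʳ-≤ 0<y (begin
    0# * y            ≈⟨ zeroˡ y ⟩
    0#                ≲⟨ 0≤x ⟩
    x                 ≈⟨ /-*-cancel x 0<y ⟨
    x / y [ 0<y ] * y ∎)

  /-≤-/⇒*≤* : ∀ {x y u v} (0<y : 0# < y) (0<v : 0# < v) →
    x / y [ 0<y ] ≤ u / v [ 0<v ] → x * v ≤ u * y
  /-≤-/⇒*≤* {x} {y} {u} {v} 0<y 0<v p = begin
    x * v                      ≈⟨ *-congʳ (/-*-cancel x 0<y) ⟨
    x / y [ 0<y ] * y * v      ≈⟨ *-assoc _ y v ⟩
    x / y [ 0<y ] * (y * v)    ≲⟨ *-monoˡ-≤ (<⇒≤ (*-pos 0<y 0<v)) p ⟩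
    u / v [ 0<v ] * (y * v)    ≈⟨ solve 3 (λ q y v → q :* (y :* v) := q :* v :* y) refl _ y v ⟩
    u / v [ 0<v ] * v * y      ≈⟨ *-congʳ (/-*-cancel u 0<v) ⟩
    u * y                      ∎

  /-+-≤-/⇒*+*≤* : ∀ {x y u v β} (0<y : 0# < y) (0<v : 0# < v) →
    x / y [ 0<y ] + β ≤ u / v [ 0<v ] → x * v + β * (v * y) ≤ u * y
  /-+-≤-/⇒*+*≤* {x} {y} {u} {v} {β} 0<y 0<v p = begin
    x * v + β * (v * y)
      ≈⟨ +-congʳ (*-congʳ (/-*-cancel x 0<y)) ⟨
    x / y [ 0<y ] * y * v + β * (v * y)
      ≈⟨ solve 4 (λ q β y v → q :* y :* v :+ β :* (v :* y) := (q :+ β) :* (v :* y)) refl _ β y v ⟩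
    (x / y [ 0<y ] + β) * (v * y)
      ≲⟨ *-monoˡ-≤ (<⇒≤ (*-pos 0<v 0<y)) p ⟩
    u / v [ 0<v ] * (v * y)
      ≈⟨ *-assoc _ v y ⟨
    u / v [ 0<v ] * v * y
      ≈⟨ *-congʳ (/-*-cancel u 0<v) ⟩
    u * y ∎

  -- With `x`, `x′` the cuts of a set and its complement and `y`, `z` their volumes, this is ncut(S)
  -- vol(S) vol(∁S) = cut(S) vol(V).
  /-+-/-common : ∀ {x x′ y z} (0<y : 0# < y) (0<z : 0# < z) → x′ ≈ x →
    (x / y [ 0<y ] + x′ / z [ 0<z ]) * (y * z) ≈ x * (y + z)
  /-+-/-common {x} {x′} {y} {z} 0<y 0<z x′≈x = begin-equality
    (x / y [ 0<y ] + x′ / z [ 0<z ]) * (y * z)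
      ≈⟨ solve 4 (λ p q y z → (p :+ q) :* (y :* z) := p :* y :* z :+ q :* z :* y) refl _ _ y z ⟩
    x / y [ 0<y ] * y * z + x′ / z [ 0<z ] * z * y
      ≈⟨ +-cong (*-congʳ (/-*-cancel x 0<y)) (*-congʳ (trans (/-*-cancel x′ 0<z) x′≈x)) ⟩
    x * z + x * y
      ≈⟨ solve 3 (λ x y z → x :* z :+ x :* y := x :* (y :+ z)) refl x y z ⟩
    x * (y + z) ∎

  -- At `x = β` and `y = 2μ` this turns the lower bound on `β` into positivity of the denominator in
  -- the approximation factor.
  0<x+y*x-y : ∀ {x y} (0<1+y : 0# < 1# + y) → y / (1# + y) [ 0<1+y ] < x → 0# < x + y * x - y
  0<x+y*x-y {x} {y} 0<1+y p =
    x<y⇒0<y-x (<-respˡ-≈ (/-*-cancel y 0<1+y) (<-respʳ-≈ expand (*-monoˡ-< 0<1+y p)))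
    where
    expand : x * (1# + y) ≈ x + y * x
    expand = trans (distribˡ x 1# y) (+-cong (*-identityʳ x) (*-comm x y))

  x+y*x-y≈x : ∀ {x y} → y ≈ 0# → x + y * x - y ≈ x
  x+y*x-y≈x {x} {y} y≈0 = begin-equality
    x + y * x - y    ≈⟨ +-cong (+-congˡ (*-congʳ y≈0)) (-‿cong y≈0) ⟩
    x + 0# * x - 0#  ≈⟨ +-cong (+-congˡ (zeroˡ x)) -0#≈0# ⟩
    x + 0# + 0#      ≈⟨ trans (+-identityʳ (x + 0#)) (+-identityʳ x) ⟩
    x                ∎

  x+x≈2*x : ∀ x → x + x ≈ 2# * x
  x+x≈2*x x = sym (trans (distribʳ x 1# 1#) (+-cong (*-identityˡ x) (*-identityˡ x)))

  -- The final comparison in the abstract: `X`, `Y` stand for the ncuts of `S*` and `T`, `p`, `q`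
  -- for their cuts, `ω`, `ω′` for their values of Ω, `x`, `y` for their products vol(S) vol(∁S),
  -- `v` for vol(V) and `r` for vol(∁R). Multiplying the claim by the positive `x * (D * y)` leaves
  -- only products, so the merely nonnegative quantities are never divided by.
  rescaled-≤ : ∀ {p q v r ω ω′ x y D X Y} → 0# ≤ p → 0# ≤ q → 0# ≤ v → 0# ≤ r →
    0# < x → 0# < y → (0<D : 0# < D) →
    X * x ≈ p * v → Y * y ≈ q * v →
    r * ω ≤ x → D * y ≤ r * ω′ → p * ω′ ≤ q * ω →
    X ≤ (1# / D [ 0<D ]) * Y
  rescaled-≤ {p} {q} {v} {r} {ω} {ω′} {x} {y} {D} {X} {Y}
    0≤p 0≤q 0≤v 0≤r 0<x 0<y 0<D Xx≈pv Yy≈qv rω≤x Dy≤rω′ pω′≤qω =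
    *-cancelʳ-≤ (*-pos 0<x (*-pos 0<D 0<y)) (begin
      X * (x * (D * y))
        ≈⟨ *-assoc X x (D * y) ⟨
      X * x * (D * y)
        ≈⟨ *-congʳ Xx≈pv ⟩
      p * v * (D * y)
        ≲⟨ *-monoʳ-≤ (*-nonneg 0≤p 0≤v) Dy≤rω′ ⟩
      p * v * (r * ω′)
        ≈⟨ solve 4 (λ p v r ω → p :* v :* (r :* ω) := v :* r :* (p :* ω)) refl p v r ω′ ⟩
      v * r * (p * ω′)
        ≲⟨ *-monoʳ-≤ (*-nonneg 0≤v 0≤r) pω′≤qω ⟩
      v * r * (q * ω)
        ≈⟨ solve 4 (λ q v r ω → v :* r :* (q :* ω) := q :* v :* (r :* ω)) refl q v r ω ⟩
      q * v * (r * ω)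
        ≲⟨ *-monoʳ-≤ (*-nonneg 0≤q 0≤v) rω≤x ⟩
      q * v * x
        ≈⟨ *-congʳ Yy≈qv ⟨
      Y * y * x
        ≈⟨ *-congʳ (*-identityˡ (Y * y)) ⟨
      1# * (Y * y) * x
        ≈⟨ *-congʳ (*-congʳ (/-*-cancel 1# 0<D)) ⟨
      1# / D [ 0<D ] * D * (Y * y) * x
        ≈⟨ solve 5 (λ i D Y y x → i :* D :* (Y :* y) :* x := i :* Y :* (x :* (D :* y))) refl (1# / D [ 0<D ]) D Y y x ⟩
      1# / D [ 0<D ] * Y * (x * (D * y)) ∎)

  -- The identity for Ω and its two bounds, in terms of the four volumes.

  module _ {a b a′ b′ ε₀ ε : Carrier} (ε₀-ratio : ε₀ * (b + b′) ≈ a + a′) where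
    private
      r′ = b + b′
      Ωₛ = a - ε * b
      μ  = ε - ε₀

    Ω-identity : r′ * Ωₛ + (μ * (r′ * b) + a′ * b) ≈ a * b′
    -- The added `a * b` completes `a′ * b` to `(a + a′) * b`, which is `ε₀ * r′ * b`. This merges
    -- with the `μ` term into `ε * b * r′` and cancels the subtraction in `Ωₛ`.
    Ω-identity = +-cancelʳ (a * b) _ _ (begin-equality
      r′ * Ωₛ + (μ * (r′ * b) + a′ * b) + a * b
        ≈⟨ solve 6 (λ r Ω m b a′ a →
             r :* Ω :+ (m :* (r :* b) :+ a′ :* b) :+ a :* b :=
             r :* Ω :+ m :* (r :* b) :+ (a :+ a′) :* b) refl r′ Ωₛ μ b a′ a ⟩
      r′ * Ωₛ + μ * (r′ * b) + (a + a′) * b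
        ≈⟨ +-congˡ (*-congʳ ε₀-ratio) ⟨
      r′ * Ωₛ + μ * (r′ * b) + ε₀ * r′ * b
        ≈⟨ solve 5 (λ r Ω m e b →
             r :* Ω :+ m :* (r :* b) :+ e :* r :* b :=
             r :* (Ω :+ (m :+ e) :* b)) refl r′ Ωₛ μ ε₀ b ⟩
      r′ * (Ωₛ + (μ + ε₀) * b)
        ≈⟨ *-congˡ (+-congˡ (*-congʳ (//-rightDividesˡ ε₀ ε))) ⟩
      r′ * (Ωₛ + ε * b)
        ≈⟨ *-congˡ (//-rightDividesˡ (ε * b) a) ⟩
      r′ * a
        ≈⟨ solve 3 (λ a b b′ → (b :+ b′) :* a := a :* b′ :+ a :* b) refl a b b′ ⟩
      a * b′ + a * b ∎)

    module _ (0≤a : 0# ≤ a) (0≤b : 0# ≤ b) (0≤a′ : 0# ≤ a′) (0≤b′ : 0# ≤ b′) (ε₀≤ε : ε₀ ≤ ε) where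
      private
        0≤μ : 0# ≤ μ
        0≤μ = x≤y⇒0≤y-x ε₀≤ε

        0≤r′ : 0# ≤ r′
        0≤r′ = +-nonneg 0≤b 0≤b′

      Ω-upper : r′ * Ωₛ ≤ (a + b) * (a′ + b′)
      Ω-upper = begin
        r′ * Ωₛ
          ≲⟨ 0≤y⇒x≤x+y (+-nonneg (*-nonneg 0≤μ (*-nonneg 0≤r′ 0≤b)) (*-nonneg 0≤a′ 0≤b)) ⟩
        r′ * Ωₛ + (μ * (r′ * b) + a′ * b)
          ≈⟨ Ω-identity ⟩
        a * b′
          -- `a * b′` is one of the four nonnegative terms in the expansion of the product of
          -- volumes.
          ≲⟨ 0≤y⇒x≤x+y (+-nonneg (*-nonneg 0≤a 0≤a′) (*-nonneg 0≤b (+-nonneg 0≤a′ 0≤b′))) ⟩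
        a * b′ + (a * a′ + b * (a′ + b′))
          ≈⟨ solve 4 (λ a b a′ b′ → a :* b′ :+ (a :* a′ :+ b :* (a′ :+ b′)) := (a :+ b) :* (a′ :+ b′)) refl a b a′ b′ ⟩
        (a + b) * (a′ + b′) ∎

      -- The last hypothesis is the overlap condition with denominators cleared. The factor `k` is
      -- kept general and becomes 2 for a set of at most half the total volume.
      Ω-lower : ∀ {β k} → 0# ≤ k → r′ ≤ k * (a′ + b′) →
        a′ * (a + b) + β * ((a + b) * (a′ + b′)) ≤ a * (a′ + b′) →
        (β + k * μ * β - k * μ) * ((a + b) * (a′ + b′)) ≤ r′ * Ωₛ
      -- Adding `k * μ * tt′` removes the subtraction in `D`, leaving one bound for `β * tt′` and
      -- one for the terms multiplied by `μ`.
      Ω-lower {β} {k} 0≤k r′≤kt′ excess = +-cancelʳ-≤ (k * μ * tt′) (begin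
        D * tt′ + k * μ * tt′
          ≈⟨ distribʳ tt′ D (k * μ) ⟨
        (D + k * μ) * tt′
          ≈⟨ *-congʳ (//-rightDividesˡ (k * μ) (β + k * μ * β)) ⟩
        (β + k * μ * β) * tt′
          ≈⟨ solve 4 (λ β k m u → (β :+ k :* m :* β) :* u := β :* u :+ m :* (k :* (β :* u))) refl β k μ tt′ ⟩
        β * tt′ + μ * (k * (β * tt′))
          ≲⟨ +-monoˡ-≤ _ βtt′-bound ⟩
        r′ * Ωₛ + μ * (r′ * b) + μ * (k * (β * tt′))
          ≈⟨ solve 4 (λ x m y z → x :+ m :* y :+ m :* z := x :+ m :* (y :+ z)) refl (r′ * Ωₛ) μ (r′ * b) (k * (β * tt′)) ⟩
        r′ * Ωₛ + μ * (r′ * b + k * (β * tt′))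
          ≲⟨ +-monoʳ-≤ _ (*-monoʳ-≤ 0≤μ error-bound) ⟩
        r′ * Ωₛ + μ * (k * tt′)
          ≈⟨ solve 4 (λ x m k u → x :+ m :* (k :* u) := x :+ k :* m :* u) refl (r′ * Ωₛ) μ k tt′ ⟩
        r′ * Ωₛ + k * μ * tt′ ∎)
        where
        t   = a + b
        t′  = a′ + b′
        tt′ = t * t′
        D   = β + k * μ * β - k * μ

        βtt′-bound : β * tt′ ≤ r′ * Ωₛ + μ * (r′ * b)
        -- The overlap condition bounds the left side by `a * t′`, whose part `a * b′` is rewritten
        -- by the identity for Ω; the `a′` terms then gather into `a′ * t`.
        βtt′-bound = +-cancelʳ-≤ (a′ * t) (begin
          β * tt′ + a′ * t
            ≈⟨ +-comm (β * tt′) (a′ * t) ⟩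
          a′ * t + β * tt′
            ≲⟨ excess ⟩
          a * t′
            ≈⟨ distribˡ a a′ b′ ⟩
          a * a′ + a * b′
            ≈⟨ +-congˡ Ω-identity ⟨
          a * a′ + (r′ * Ωₛ + (μ * (r′ * b) + a′ * b))
            ≈⟨ solve 5 (λ x y a a′ b → a :* a′ :+ (x :+ (y :+ a′ :* b)) := x :+ y :+ a′ :* (a :+ b))
                 refl (r′ * Ωₛ) (μ * (r′ * b)) a a′ b ⟩
          r′ * Ωₛ + μ * (r′ * b) + a′ * t ∎)

        βtt′≤at′ : β * tt′ ≤ a * t′
        βtt′≤at′ = begin
          β * tt′          ≲⟨ 0≤y⇒x≤x+y (*-nonneg 0≤a′ (+-nonneg 0≤a 0≤b)) ⟩
          β * tt′ + a′ * t ≈⟨ +-comm (β * tt′) (a′ * t) ⟩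
          a′ * t + β * tt′ ≲⟨ excess ⟩
          a * t′           ∎

        error-bound : r′ * b + k * (β * tt′) ≤ k * tt′
        -- Both summands are enlarged to multiples of `k * t′`, by `b` and by `a`, which recombine
        -- to `t`.
        error-bound = begin
          r′ * b + k * (β * tt′)
            ≲⟨ +-monoˡ-≤ _ (*-monoˡ-≤ 0≤b r′≤kt′) ⟩
          k * t′ * b + k * (β * tt′)
            ≲⟨ +-monoʳ-≤ _ (*-monoʳ-≤ 0≤k βtt′≤at′) ⟩
          k * t′ * b + k * (a * t′)
            ≈⟨ solve 4 (λ k u a b → k :* u :* b :+ k :* (a :* u) := k :* ((a :+ b) :* u)) refl k t′ a b ⟩
          k * tt′ ∎

-- Cuts, degrees and volumes of a hypergraph.

module HypergraphProperties {c ℓ₁ ℓ₂ ℓ₃} (F : OrderedField c ℓ₁ ℓ₂ ℓ₃) (H : Hypergraph F) where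
  open OrderedField F hiding (zero)
  open Hypergraph H
  open OrderedFieldProperties F
  open Sum +-commutativeMonoid using (sum-cong-≋; ∑-distrib-+)
  open RingProperties ring using (//-rightDividesˡ)
  open CommutativeSemigroupProperties (CommutativeMonoid.commutativeSemigroup +-commutativeMonoid) using (interchange)
  open PreorderReasoning ≤-preorder

  cut-nonneg : ∀ S → 0# ≤ cut S
  cut-nonneg S = sum-nonneg {m} _ (λ i → w-nonneg i (p∩q⊆p (edge i) S))

  cut-∁ : ∀ S → cut (∁ S) ≈ cut S
  cut-∁ S = sum-cong-≋ {m} λ i → sym (trans
    (w-symmetric i (p∩q⊆p (edge i) S))
    (reflexive (≡.cong (w i) (≡.sym (∩-∁-relative (edge i) S)))))

  degree-nonneg : ∀ v → 0# ≤ degree v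
  degree-nonneg v = sum-nonneg {m} _ term-nonneg
    where
    term-nonneg : ∀ i → 0# ≤ (if does (v ∈? edge i) then w i ⁅ v ⁆ else 0#)
    term-nonneg i with v ∈? edge i
    ... | no  _   = ≤-reflexive refl
    -- Nonnegativity of `w` is available only on subsets of the edge, so the singleton must be shown
    -- to lie in it.
    ... | yes v∈e = w-nonneg i λ x∈⁅v⁆ → ≡.subst (_∈ edge i) (≡.sym (x∈⁅y⁆⇒x≡y v x∈⁅v⁆)) v∈e

  vol-nonneg : ∀ S → 0# ≤ vol S
  vol-nonneg S = sum-nonneg {n} _ term-nonneg
    where
    term-nonneg : ∀ v → 0# ≤ (if does (v ∈? S) then degree v else 0#)
    term-nonneg v with does (v ∈? S)
    ... | true  = degree-nonneg v
    ... | false = ≤-reflexive refl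

  vol-split : ∀ S R → vol S ≈ vol (S ∩ R) + vol (S ∩ ∁ R)
  vol-split S R = trans (sum-cong-≋ {n} split) (∑-distrib-+ {n} _ _)
    where
    term : Bool → Fin n → Carrier
    term b v = if b then degree v else 0#

    split-Bool : ∀ s r v → term s v ≈ term (s ∧ r) v + term (s ∧ not r) v
    split-Bool true  true  v = sym (+-identityʳ _)
    split-Bool true  false v = sym (+-identityˡ _)
    split-Bool false r     v = sym (+-identityˡ _)

    split : ∀ v → term (does (v ∈? S)) v ≈
      term (does (v ∈? S ∩ R)) v + term (does (v ∈? S ∩ ∁ R)) v
    split v
      rewrite does-∈? v S | does-∈? v (S ∩ R) | does-∈? v (S ∩ ∁ R)
            | lookup-zipWith _∧_ v S R | lookup-zipWith _∧_ v S (∁ R) | lookup-map v not R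
      = split-Bool (lookup S v) (lookup R v) v

  vol-splitʳ : ∀ S R → vol R ≈ vol (S ∩ R) + vol (∁ S ∩ R)
  vol-splitʳ S R = trans (vol-split R S)
    (reflexive (≡.cong₂ (λ A B → vol A + vol B) (∩-comm R S) (∩-comm R (∁ S))))

  -- Both sides add up the same four cells cut out by `S` and `R`. The right side serves as vol(V),
  -- a common factor for the ncuts of `S*` and `T`.
  vol-total : ∀ S R → vol S + vol (∁ S) ≈ vol R + vol (∁ R)
  vol-total S R = begin-equality
    vol S + vol (∁ S)
      ≈⟨ +-cong (vol-split S R) (vol-split (∁ S) R) ⟩
    (vol (S ∩ R) + vol (S ∩ ∁ R)) + (vol (∁ S ∩ R) + vol (∁ S ∩ ∁ R))
      ≈⟨ interchange _ _ _ _ ⟩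
    (vol (S ∩ R) + vol (∁ S ∩ R)) + (vol (S ∩ ∁ R) + vol (∁ S ∩ ∁ R))
      ≈⟨ +-cong (vol-splitʳ S R) (vol-splitʳ S (∁ R)) ⟨
    vol R + vol (∁ R) ∎

  -- Bounds on Ω for sets of nodes, and the use of minimality.

  module _ {R : Subset n} (0<vol∁R : 0# < vol (∁ R))
           {ε : Carrier} (ε₀≤ε : vol R / vol (∁ R) [ 0<vol∁R ] ≤ ε) where
    private
      ε₀ = vol R / vol (∁ R) [ 0<vol∁R ]
      μ  = ε - ε₀

      ε₀-ratio : ∀ S → ε₀ * (vol (S ∩ ∁ R) + vol (∁ S ∩ ∁ R)) ≈ vol (S ∩ R) + vol (∁ S ∩ R)
      ε₀-ratio S = begin-equality
        ε₀ * (vol (S ∩ ∁ R) + vol (∁ S ∩ ∁ R)) ≈⟨ *-congˡ (vol-splitʳ S (∁ R)) ⟨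
        ε₀ * vol (∁ R)                         ≈⟨ /-*-cancel (vol R) 0<vol∁R ⟩
        vol R                                  ≈⟨ vol-splitʳ S R ⟩
        vol (S ∩ R) + vol (∁ S ∩ R)            ∎

    vol∁R*Ω≤volS*vol∁S : ∀ S → vol (∁ R) * Ω R ε S ≤ vol S * vol (∁ S)
    vol∁R*Ω≤volS*vol∁S S = begin
      vol (∁ R) * Ω R ε S
        ≈⟨ *-congʳ (vol-splitʳ S (∁ R)) ⟩
      (vol (S ∩ ∁ R) + vol (∁ S ∩ ∁ R)) * Ω R ε S
        ≲⟨ Ω-upper (ε₀-ratio S) (vol-nonneg _) (vol-nonneg _) (vol-nonneg _) (vol-nonneg _) ε₀≤ε ⟩
      (vol (S ∩ R) + vol (S ∩ ∁ R)) * (vol (∁ S ∩ R) + vol (∁ S ∩ ∁ R))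
        ≈⟨ *-cong (vol-split S R) (vol-split (∁ S) R) ⟨
      vol S * vol (∁ S) ∎

    D*volT*vol∁T≤vol∁R*Ω : ∀ {T β} → vol T ≤ vol (∁ T) →
      (0<volT : 0# < vol T) (0<vol∁T : 0# < vol (∁ T)) →
      vol (∁ T ∩ R) / vol (∁ T) [ 0<vol∁T ] + β ≤ vol (T ∩ R) / vol T [ 0<volT ] →
      (β + 2# * μ * β - 2# * μ) * (vol T * vol (∁ T)) ≤ vol (∁ R) * Ω R ε T
    D*volT*vol∁T≤vol∁R*Ω {T} {β} volT≤vol∁T 0<volT 0<vol∁T excess = begin
      (β + 2# * μ * β - 2# * μ) * (vol T * vol (∁ T))
        ≈⟨ *-congˡ (*-cong t-split t′-split) ⟩
      (β + 2# * μ * β - 2# * μ) *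
        ((vol (T ∩ R) + vol (T ∩ ∁ R)) * (vol (∁ T ∩ R) + vol (∁ T ∩ ∁ R)))
        ≲⟨ Ω-lower (ε₀-ratio T) (vol-nonneg _) (vol-nonneg _) (vol-nonneg _) (vol-nonneg _) ε₀≤ε
             0≤2 r′≤2t′ excess′ ⟩
      (vol (T ∩ ∁ R) + vol (∁ T ∩ ∁ R)) * Ω R ε T
        ≈⟨ *-congʳ (vol-splitʳ T (∁ R)) ⟨
      vol (∁ R) * Ω R ε T ∎
      where
      t-split  = vol-split T R
      t′-split = vol-split (∁ T) R

      0≤2 : 0# ≤ 2#
      0≤2 = +-nonneg 0≤1 0≤1

      r′≤2t′ : vol (T ∩ ∁ R) + vol (∁ T ∩ ∁ R) ≤ 2# * (vol (∁ T ∩ R) + vol (∁ T ∩ ∁ R))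
      -- vol(∁R) is at most the total volume, of which `∁ T` carries at least half.
      r′≤2t′ = begin
        vol (T ∩ ∁ R) + vol (∁ T ∩ ∁ R) ≈⟨ vol-splitʳ T (∁ R) ⟨
        vol (∁ R)                       ≲⟨ 0≤y⇒x≤x+y (vol-nonneg R) ⟩
        vol (∁ R) + vol R               ≈⟨ +-comm _ _ ⟩
        vol R + vol (∁ R)               ≈⟨ vol-total T R ⟨
        vol T + vol (∁ T)               ≲⟨ +-monoˡ-≤ _ volT≤vol∁T ⟩
        vol (∁ T) + vol (∁ T)           ≈⟨ x+x≈2*x _ ⟩
        2# * vol (∁ T)                  ≈⟨ *-congˡ t′-split ⟩
        2# * (vol (∁ T ∩ R) + vol (∁ T ∩ ∁ R)) ∎

      excess′ : vol (∁ T ∩ R) * (vol (T ∩ R) + vol (T ∩ ∁ R)) +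
          β * ((vol (T ∩ R) + vol (T ∩ ∁ R)) * (vol (∁ T ∩ R) + vol (∁ T ∩ ∁ R)))
        ≤ vol (T ∩ R) * (vol (∁ T ∩ R) + vol (∁ T ∩ ∁ R))
      excess′ = begin
        _ ≈⟨ +-cong (*-congˡ t-split) (*-congˡ (*-cong t-split t′-split)) ⟨
        vol (∁ T ∩ R) * vol T + β * (vol T * vol (∁ T))
          ≲⟨ /-+-≤-/⇒*+*≤* 0<vol∁T 0<volT excess ⟩
        vol (T ∩ R) * vol (∁ T)
          ≈⟨ *-congˡ t′-split ⟩
        _ ∎

    -- As `ε` is at least `ε₀`, it is nonnegative, so Ω never exceeds vol(S ∩ R).
    0<Ω⇒0<vol : ∀ S → 0# < Ω R ε S → 0# < vol S
    0<Ω⇒0<vol S 0<Ω = <-≤-trans 0<Ω (begin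
      Ω R ε S
        ≲⟨ 0≤y⇒x≤x+y (*-nonneg 0≤ε (vol-nonneg (S ∩ ∁ R))) ⟩
      Ω R ε S + ε * vol (S ∩ ∁ R)
        ≈⟨ //-rightDividesˡ (ε * vol (S ∩ ∁ R)) (vol (S ∩ R)) ⟩
      vol (S ∩ R)
        ≲⟨ 0≤y⇒x≤x+y (vol-nonneg (S ∩ ∁ R)) ⟩
      vol (S ∩ R) + vol (S ∩ ∁ R)
        ≈⟨ vol-split S R ⟨
      vol S ∎)
      where
      0≤ε : 0# ≤ ε
      0≤ε = ≤-trans (/-nonneg 0<vol∁R (vol-nonneg R)) ε₀≤ε

    -- The upper bound on Ω makes vol(S) vol(∁S) positive, and the positive factor vol(S) cancels.
    0<Ω⇒0<vol∁ : ∀ S → 0# < Ω R ε S → 0# < vol (∁ S)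
    0<Ω⇒0<vol∁ S 0<Ω = *-pos-cancelˡ (0<Ω⇒0<vol S 0<Ω)
      (<-≤-trans (*-pos 0<vol∁R 0<Ω) (vol∁R*Ω≤volS*vol∁S S))

    -- A quotient carries a positivity proof for its denominator. Quantifying over `D′ ≈ D` lets the
    -- general bound and the special case with denominator `β` share the same volume proofs.
    minimizer-ncut : ∀ {S* T} → IsMinimizerHLC R ε S* → (0<volT : 0# < vol T) (0<vol∁T : 0# < vol (∁ T)) →
      ∀ {D} (0<D : 0# < D) → D * (vol T * vol (∁ T)) ≤ vol (∁ R) * Ω R ε T →
      Σ[ 0<volS* ∈ 0# < vol S* ] Σ[ 0<vol∁S* ∈ 0# < vol (∁ S*) ]
        (∀ {D′} (0<D′ : 0# < D′) → D′ ≈ D →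
          ncut S* 0<volS* 0<vol∁S* ≤ (1# / D′ [ 0<D′ ]) * ncut T 0<volT 0<vol∁T)
    minimizer-ncut {S*} {T} minimal 0<volT 0<vol∁T {D} 0<D D-bound =
      0<volS* , 0<vol∁S* , λ {D′} 0<D′ D′≈D →
        rescaled-≤ (cut-nonneg S*) (cut-nonneg T) (+-nonneg (vol-nonneg R) (vol-nonneg (∁ R)))
          (vol-nonneg (∁ R)) (*-pos 0<volS* 0<vol∁S*) 0<tt′ 0<D′
          (trans (/-+-/-common 0<volS* 0<vol∁S* (cut-∁ S*)) (*-congˡ (vol-total S* R)))
          (trans (/-+-/-common 0<volT 0<vol∁T (cut-∁ T)) (*-congˡ (vol-total T R)))
          (vol∁R*Ω≤volS*vol∁S S*)
          (≤-trans (≤-reflexive (*-congʳ D′≈D)) D-bound)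
          (/-≤-/⇒*≤* 0<ΩS* 0<ΩT (proj₂ (minimal T 0<ΩT)))
      where
      0<tt′ = *-pos 0<volT 0<vol∁T

      -- The lower bound makes HLC(T) finite; minimality then makes HLC(S*) finite, which is where
      -- positivity of both volumes for `S*` comes from.
      0<ΩT : 0# < Ω R ε T
      0<ΩT = *-pos-cancelˡ 0<vol∁R (<-≤-trans (*-pos 0<D 0<tt′) D-bound)

      0<ΩS* : 0# < Ω R ε S*
      0<ΩS* = proj₁ (minimal T 0<ΩT)

      0<volS*  = 0<Ω⇒0<vol S* 0<ΩS*
      0<vol∁S* = 0<Ω⇒0<vol∁ S* 0<ΩS*

theorem5 : ∀ {c ℓ₁ ℓ₂ ℓ₃} (F : OrderedField c ℓ₁ ℓ₂ ℓ₃) (H : Hypergraph F) →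
    let open OrderedField F
        open Hypergraph H
    in
    (R : Subset n) (0<volR : 0# < vol R) (volR≤vol∁R : vol R ≤ vol (∁ R)) →
    let ε₀ = vol R / vol (∁ R) [ <-≤-trans 0<volR volR≤vol∁R ] in
    (ε : Carrier) (ε₀≤ε : ε₀ ≤ ε) (ε<ε₀+1 : ε < ε₀ + 1#) →
    let μ = ε - ε₀ in
    (S* : Subset n) → IsMinimizerHLC R ε S* →
    (T : Subset n) (0<volT : 0# < vol T) (volT≤vol∁T : vol T ≤ vol (∁ T)) →
    let 0<vol∁T = <-≤-trans 0<volT volT≤vol∁T in
    (β : Carrier) →
    (2# * μ) / (1# + 2# * μ) [ 0<1+2[y-x] ε₀≤ε ] < β → β < 1# →
    vol (∁ T ∩ R) / vol (∁ T) [ 0<vol∁T ] + β ≤ vol (T ∩ R) / vol T [ 0<volT ] →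
    let D = β + 2# * μ * β - 2# * μ in
    Σ[ 0<volS* ∈ 0# < vol S* ] Σ[ 0<vol∁S* ∈ 0# < vol (∁ S*) ]
      ( (Σ[ 0<D ∈ 0# < D ]
           ncut S* 0<volS* 0<vol∁S* ≤ (1# / D [ 0<D ]) * ncut T 0<volT 0<vol∁T)
      × (ε ≈ ε₀ →
           Σ[ 0<β ∈ 0# < β ]
             ncut S* 0<volS* 0<vol∁S* ≤ (1# / β [ 0<β ]) * ncut T 0<volT 0<vol∁T) )
theorem5 F H R 0<volR volR≤vol∁R ε ε₀≤ε _ S* minimal T 0<volT volT≤vol∁T β β-lower _ excess =
  let 0<volS* , 0<vol∁S* , bound =
        minimizer-ncut 0<vol∁R ε₀≤ε minimal 0<volT 0<vol∁T 0<D
          (D*volT*vol∁T≤vol∁R*Ω 0<vol∁R ε₀≤ε volT≤vol∁T 0<volT 0<vol∁T excess)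
  in 0<volS* , 0<vol∁S* , (0<D , bound 0<D refl) , λ ε≈ε₀ →
       -- For `ε ≈ ε₀` the quantity `2# * μ` vanishes, so the denominator reduces to `β`.
       let β≈D = sym (x+y*x-y≈x (trans (*-congˡ (trans (+-congʳ ε≈ε₀) (-‿inverseʳ _))) (zeroʳ 2#)))
           0<β = <-respʳ-≈ (sym β≈D) 0<D
       in 0<β , bound 0<β β≈D
  where
  open OrderedField F
  open Hypergraph H
  open OrderedFieldProperties F
  open HypergraphProperties F H

  0<vol∁R = <-≤-trans 0<volR volR≤vol∁R
  0<vol∁T = <-≤-trans 0<volT volT≤vol∁T
  0<D     = 0<x+y*x-y (0<1+2[y-x] ε₀≤ε) β-lower
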